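{- (a) Let $X$ be a non-empty set and let $S\subseteq \mathrm{Der}(X)$ be a finite non-empty set of derangements of $X$. Then the following three conditions are equivalent: (1) the group action digraph $\overrightarrow{\mathrm{GA}}(X,S)$ is multiplicity-free; (2) $SS^{ -1}\subseteq \mathrm{Der}(X)\cup\{1\}$; (3) the derangement action digraph $\overrightarrow{\mathrm{DA}}(X,S)$ is regular of valency $|S|$. (b) Every finite simple regular digraph is a derangement action digraph.
   Context: For a set $X$, $\mathrm{Sym}(X)$ is the group of all permutations of $X$, acting on the right: $x^s$ is the image of $x$ under $s$, and $x^{st}=(x^s)^t$. A derangement of $X$ is a permutation of $X$ with no fixed points; $\mathrm{Der}(X)$ is the set of derangements of $X$. For subsets $A,B\subseteq\mathrm{Sym}(X)$, $AB=\{ab : a\in A,b\in B\}$ and $A^{ -1}=\{a^{ -1}: a\in A\}$; $1$ denotes the identity permutation. A simple digraph is a pair $\Gamma=(X,A)$ with vertex set $X$ and arc set $A\subseteq\{(u,v): u,v\in X, u\neq v\}$. If $(x,y)\in A$ then $y$ is an out-neighbour of $x$ and $x$ is an in-neighbour of $y$; the out-valency (in-valency) of $x$ is its number of out-neighbours (in-neighbours). $\Gamma$ is regular of valency $k$ if every vertex has out-valency $k$ and in-valency $k$, and regular if this holds for some constant $k$. For non-empty $X$ and non-empty $S\subseteq \mathrm{Der}(X)$, the derangement action digraph $\overrightarrow{\mathrm{DA}}(X,S)$ is the simple digraph with vertex set $X$ and arc set $\{(x,x^s): x\in X, s\in S\}$ (a set of ordered pairs, without multiplicities). A simple digraph is called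 a derangement action digraph if it equals $\overrightarrow{\mathrm{DA}}(X,S)$ for some such $X$ and $S$. The group action digraph $\overrightarrow{\mathrm{GA}}(X,S)$ has vertex set $X$ and, for each $x\in X$ and $s\in S$, an arc labelled $s$ from $x$ to $x^s$; it is multiplicity-free if for all $(v,u)\in X\times X$ there is at most one $s\in S$ with $v^s=u$.
   Formalization: In (b) the digraph is assumed to have at least one arc: an arcless digraph is regular of valency 0 but is never a derangement action digraph, since X and S must be non-empty. -}

module Defs where

open import Algebra.Bundles using (Group)
open import Data.Fin.Base using (Fin)
open import Data.Nat.Base using (ℕ)
open import Data.Product.Base using (Σ; ∃; ∃₂; _×_; _,_; proj₁)
open import Function.Bundles using (Bijection; Inverse; _⇔_; _↔_)
open import Function.Construct.Composition using (_↔-∘_)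
open import Function.Construct.Identity using (↔-id)
open import Function.Construct.Symmetry using (↔-sym)
open import Level using (Level; suc; _⊔_)
open import Relation.Binary.Bundles using (Setoid)
open import Relation.Binary.Core using (Rel)
open import Relation.Binary.Definitions using (Irreflexive; _Respects_)
import Relation.Binary.Construct.On as On
open import Relation.Binary.PropositionalEquality
  using (_≡_; _≢_; refl; sym; trans; cong; setoid)
open import Relation.Unary using (Pred; Satisfiable; _⊆_)

private
  variable
    a p ℓ : Level

-- The elements of A satisfying P, identified when they are equal in A: two
-- proofs of membership of the same element do not count as two elements.
subsetoid : (A : Setoid a ℓ) → Pred (Setoid.Carrier A) p → Setoid (a ⊔ p) ℓ
subsetoid A P = On.setoid {B = Σ (Setoid.Carrier A) P} A proj₁

HasCardinality : (A : Setoid a ℓ) → Pred (Setoid.Carrier A) p → ℕ → Set (a ⊔ ℓ ⊔ p)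
HasCardinality A P n = Bijection (setoid (Fin n)) (subsetoid A P)

Finite : Set a → Set a
Finite X = ∃ λ n → Fin n ↔ X

Perm : Set a → Set a
Perm X = X ↔ X

infixl 8 _^_
_^_ : {X : Set a} → X → Perm X → X
x ^ s = Inverse.to s x

-- Permutations act on the right, x ^ (s ∙ t) = (x ^ s) ^ t, and are equal
-- when they agree at every point.
Sym : Set a → Group a a
Sym X = record
  { Carrier = Perm X
  ; _≈_     = λ s t → ∀ x → x ^ s ≡ x ^ t
  ; _∙_     = λ s t → t ↔-∘ s
  ; ε       = ↔-id X
  ; _⁻¹     = ↔-sym
  ; isGroup = record
    { isMonoid = record
      { isSemigroup = record
        { isMagma = record
          { isEquivalence = record
            { refl  = λ x → refl
            ; sym   = λ s≈t x → sym (s≈t x)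
            ; trans = λ s≈t t≈u x → trans (s≈t x) (t≈u x)
            }
          ; ∙-cong = λ {s} {t} {u} {v} s≈t u≈v x →
              trans (cong (_^ u) (s≈t x)) (u≈v (x ^ t))
          }
        ; assoc = λ s t u x → refl
        }
      ; identity = (λ s x → refl) , (λ s x → refl)
      }
    ; inverse = (λ s → Inverse.strictlyInverseˡ s) , (λ s → Inverse.strictlyInverseʳ s)
    ; ⁻¹-cong = λ {s} {t} s≈t x →
        trans (sym (Inverse.strictlyInverseʳ t (Inverse.from s x)))
          (cong (Inverse.from t)
            (trans (sym (s≈t (Inverse.from s x))) (Inverse.strictlyInverseˡ s x)))
    }
  }

module _ (G : Group a ℓ) where
  open Group G

  ProductSet : Pred Carrier p → Pred Carrier p → Pred Carrier (a ⊔ ℓ ⊔ p)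
  ProductSet A B g = ∃₂ λ x y → A x × B y × g ≈ x ∙ y

  InverseSet : Pred Carrier p → Pred Carrier (a ⊔ ℓ ⊔ p)
  InverseSet A g = ∃ λ x → A x × g ≈ x ⁻¹

  Identity : Pred Carrier ℓ
  Identity g = g ≈ ε

Der : (X : Set a) → Pred (Perm X) a
Der X s = ∀ x → x ^ s ≢ x

record DerangementSet (X : Set ℓ) : Set (suc ℓ) where
  field
    member       : Pred (Perm X) ℓ
    respects     : member Respects Group._≈_ (Sym X)
    derangements : member ⊆ Der X
    nonempty     : Satisfiable member

record SimpleDigraph (X : Set ℓ) : Set (suc ℓ) where
  field
    Arc    : Rel X ℓ
    noLoop : Irreflexive _≡_ Arc

module _ {X : Set ℓ} (Γ : SimpleDigraph X) where
  open SimpleDigraph Γ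

  RegularOfValency : ℕ → Set ℓ
  RegularOfValency k =
    ∀ x → HasCardinality (setoid X) (λ y → Arc x y) k
        × HasCardinality (setoid X) (λ y → Arc y x) k

  Regular : Set ℓ
  Regular = ∃ RegularOfValency

  HasArc : Set ℓ
  HasArc = ∃₂ Arc

-- Equality of arc sets, for digraphs on the same vertex set.
SameArcs : {X : Set ℓ} → SimpleDigraph X → SimpleDigraph X → Set ℓ
SameArcs Γ Δ = ∀ x y → SimpleDigraph.Arc Γ x y ⇔ SimpleDigraph.Arc Δ x y

record LabelledDigraph (X : Set ℓ) : Set (suc ℓ) where
  field
    Label : Setoid ℓ ℓ
    Arc   : X → Setoid.Carrier Label → X → Set ℓ

MultiplicityFree : {X : Set ℓ} → LabelledDigraph X → Set ℓ
MultiplicityFree Γ = ∀ v u s t → Arc v s u → Arc v t u → s ≈ t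
  where
  open LabelledDigraph Γ
  open Setoid Label using (_≈_)

GA : (X : Set ℓ) → Pred (Perm X) ℓ → LabelledDigraph X
GA X S = record
  { Label = subsetoid (Group.setoid (Sym X)) S
  ; Arc   = λ x s y → x ^ proj₁ s ≡ y
  }

DA : (X : Set ℓ) → DerangementSet X → SimpleDigraph X
DA X S = record
  { Arc    = λ x y → ∃ λ s → member s × x ^ s ≡ y
  ; noLoop = λ { {x} refl (s , s∈S , xˢ≡x) → derangements s∈S x xˢ≡x }
  }
  where open DerangementSet S

IsDerangementActionDigraph : {X : Set ℓ} → SimpleDigraph X → Set (suc ℓ)
IsDerangementActionDigraph {X = X} Γ =
  X × Σ (DerangementSet X) λ S → SameArcs Γ (DA X S)

{-# OPTIONS --safe #-}

-- (a) A finite set S of permutations has decidable equality, and x is fixed by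
-- s t⁻¹ exactly when x ^ s ≡ x ^ t; so (1) and (2) both say that the maps
-- S → X, s ↦ x ^ s, are injective. Valency |S| forces this since a surjection
-- between finite sets of the same size is injective.
--
-- (b) It suffices to put every arc (x , y) of a k-regular digraph Γ into a
-- permutation all of whose pairs z ↦ z ^ s are arcs. Numbering the arcs out of
-- and into each vertex by Fin k turns "follow the arc, keep its number at the
-- head" into an injection of X × Fin k, whose orbits are closed walks. Applied
-- to Γ relabelled by a permutation s, this puts each arc (x , y) on a cycle
-- alternating between s and Γ, and switching s along it gives s′ with
-- x ^ s′ ≡ y and all moved points sent along arcs. Starting from the identity,
-- switch at one vertex after another, and at (x , y) last.
module Submission where

open import Algebra.Bundles using (Group)
open import Data.Fin.Base using (Fin; toℕ; punchOut)
open import Data.Fin.Permutation using (transpose)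
open import Data.Fin.Properties as Fin
  using (punchOut-injective; injective⇒≤; pigeonhole; inj⇒≟; *↔×)
open import Data.List.Base using (List; []; _∷_; [_]; map; allFin)
open import Data.List.Membership.Propositional using (_∈_; _∉_)
open import Data.List.Membership.Propositional.Properties using (∈-map⁺; ∈-allFin)
import Data.List.Membership.DecPropositional as DecMembership
open import Data.List.Relation.Unary.Any using (here; there)
open import Data.Nat.Base as ℕ using (ℕ; zero; suc; _+_; _∸_)
open import Data.Nat.GeneralisedArithmetic using (fold; fold-+; iterate; iterate-is-fold)
import Data.Nat.Properties as ℕ
open import Data.Product.Base using (∃; ∃₂; _×_; _,_; proj₁; proj₂)
open import Data.Product.Function.NonDependent.Propositional using (_×-↔_)
open import Data.Sum.Base as Sum using (_⊎_; inj₁; inj₂; [_,_]′)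
open import Function.Base using (id; _∘_; _$_)
open import Function.Bundles using (Bijection; Inverse; Injection; _⇔_; mk⇔; _↔_; _↣_)
open import Function.Construct.Composition using (_↔-∘_; _⇔-∘_)
open import Function.Construct.Identity using (↔-id)
open import Function.Construct.Symmetry using (↔-sym; ⇔-sym)
open import Function.Definitions using (Injective; StrictlySurjective)
open import Function.Properties.Inverse using (↔⇒↣)
open import Level using (Level; _⊔_)
open import Relation.Binary.Core using (Rel)
open import Relation.Binary.Construct.Closure.ReflexiveTransitive using (Star; ε; _◅_)
open import Relation.Binary.Definitions using (DecidableEquality)
open import Relation.Binary.PropositionalEquality
  using (_≡_; _≢_; refl; sym; trans; cong; cong₂; subst; setoid; module ≡-Reasoning)
open import Relation.Nullary using (Dec; yes; no; contradiction)
open import Relation.Nullary.Decidable using (dec-true; dec-false; map′; toSum)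
open import Relation.Unary using (Pred; _⊆_; _∪_)
open import Defs

private
  variable
    a a′ r ℓ : Level
    n k : ℕ

-- Finite sets, orbits and transpositions

↔-injective : {A : Set a} {B : Set a′} (s : A ↔ B) → Injective _≡_ _≡_ (Inverse.to s)
↔-injective s = Injection.injective (↔⇒↣ s)

surjective⇒injective : {f : Fin n → Fin n} →
  StrictlySurjective _≡_ f → Injective _≡_ _≡_ f
surjective⇒injective {suc n} {f} surj {i} {j} fi≡fj with i Fin.≟ j
... | yes i≡j = i≡j
... | no  i≢j = contradiction (injective⇒≤ missing-injective) ℕ.1+n≰n
  where
  -- A section of f that never takes the value j.
  section : ∀ y → ∃ λ x → j ≢ x × f x ≡ y
  section y with surj y
  ... | x , fx≡y with j Fin.≟ x
  ... | yes refl = i , i≢j ∘ sym , trans fi≡fj fx≡y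
  ... | no  j≢x  = x , j≢x , fx≡y

  missing : Fin (suc n) → Fin n
  missing y = punchOut (proj₁ (proj₂ (section y)))

  missing-injective : Injective _≡_ _≡_ missing
  missing-injective {y} {z} eq with section y | section z
  ... | _ , j≢x , refl | _ , j≢x′ , refl = cong f (punchOut-injective j≢x j≢x′ eq)

fold-injective : {A : Set a} {f : A → A} → Injective _≡_ _≡_ f →
  ∀ m {x y} → fold x f m ≡ fold y f m → x ≡ y
fold-injective inj zero    eq = eq
fold-injective inj (suc m) eq = fold-injective inj m (inj eq)

-- Two of the iterates 0 to `n` coincide, and injectivity cancels the earlier one. Starting at `f x`
-- makes the return to `x` use at least one application.
orbit-closed : {A : Set a} → A ↣ Fin n → {f : A → A} → Injective _≡_ _≡_ f →
  ∀ x → ∃ λ m → iterate f (f x) m ≡ x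
orbit-closed {n = n} ι {f} inj x
  with i , j , i<j , eq ← pigeonhole (ℕ.n<1+n n) (λ i → Injection.to ι (fold x f (toℕ i)))
  = d , trans (sym (iterate-is-fold x f (suc d))) (fold-injective inj (toℕ i) (begin
    fold (fold x f (suc d)) f (toℕ i) ≡⟨ fold-+ x f (toℕ i) ⟨
    fold x f (toℕ i + suc d)          ≡⟨ cong (fold x f) (trans (ℕ.+-suc (toℕ i) d) (ℕ.m+[n∸m]≡n i<j)) ⟩
    fold x f (toℕ j)                  ≡⟨ Injection.injective ι eq ⟨
    fold x f (toℕ i)                  ∎))
  where
  open ≡-Reasoning
  d = toℕ j ∸ suc (toℕ i)

transpose-first : (i j : Fin n) → i ^ transpose i j ≡ j
transpose-first i j rewrite dec-true (i Fin.≟ i) refl = refl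

transpose-second : (i j : Fin n) → j ^ transpose i j ≡ i
transpose-second i j with j Fin.≟ i
... | yes j≡i = j≡i
... | no  _ rewrite dec-true (j Fin.≟ j) refl = refl

transpose-other : ∀ {i j l : Fin n} → l ≢ i → l ≢ j → l ^ transpose i j ≡ l
transpose-other {i = i} {j} {l} l≢i l≢j
  rewrite dec-false (l Fin.≟ i) l≢i | dec-false (l Fin.≟ j) l≢j = refl

-- Multiplicity-freeness, quotients and valency

module _ {X : Set ℓ} (S : DerangementSet X)
         (card : HasCardinality (Group.setoid (Sym X)) (DerangementSet.member S) n) where

  open DerangementSet S
  open Group (Sym X) using (_≈_; _∙_)

  private
    G    = Sym X
    SS⁻¹ = ProductSet G member (InverseSet G member)
    module card = Bijection card

    perm : Fin n → Perm X
    perm i = proj₁ (card.to i)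

    perm∈S : ∀ i → member (perm i)
    perm∈S i = proj₂ (card.to i)

    index : ∀ {s} → member s → ∃ λ i → perm i ≈ s
    index {s} s∈S = card.strictlySurjective (s , s∈S)

    -- Comparing indices decides which side of `Der X ∪ Identity G` a quotient falls on.
    member-≈? : ∀ {s t} → member s → member t → Dec (s ≈ t)
    member-≈? s∈S t∈S with index s∈S | index t∈S
    ... | i , pᵢ≈s | j , pⱼ≈t = map′
      (λ { refl x → trans (sym (pᵢ≈s x)) (pⱼ≈t x) })
      (λ s≈t → card.injective λ x → trans (pᵢ≈s x) (trans (s≈t x) (sym (pⱼ≈t x))))
      (i Fin.≟ j)

    quotient-cancel : ∀ {g s t u} → u ≈ ↔-sym t → g ≈ s ∙ u →
               ∀ x → x ^ g ^ t ≡ x ^ s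
    quotient-cancel {s = s} {t} u≈t⁻¹ g≈su x =
      Inverse.inverseˡ t (trans (g≈su x) (u≈t⁻¹ (x ^ s)))

  multiplicityFree⇔quotientsDerange :
    MultiplicityFree (GA X member) ⇔ (SS⁻¹ ⊆ Der X ∪ Identity G)
  multiplicityFree⇔quotientsDerange = mk⇔ to from
    where
    to : MultiplicityFree (GA X member) → SS⁻¹ ⊆ Der X ∪ Identity G
    to mf {g} (s , u , s∈S , (t , t∈S , u≈t⁻¹) , g≈su) with member-≈? s∈S t∈S
    ... | yes s≈t = inj₂ λ x →
      ↔-injective t (trans (quotient-cancel {g} {s} {t} {u} u≈t⁻¹ g≈su x) (s≈t x))
    ... | no s≉t = inj₁ λ x xᵍ≡x → s≉t $
      mf x (x ^ s) (s , s∈S) (t , t∈S) refl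
        (trans (cong (_^ t) (sym xᵍ≡x)) (quotient-cancel {g} {s} {t} {u} u≈t⁻¹ g≈su x))

    from : SS⁻¹ ⊆ Der X ∪ Identity G → MultiplicityFree (GA X member)
    from der v u (s , s∈S) (t , t∈S) vˢ≡u vᵗ≡u
      -- `s` and `t` agree at `v`, so this quotient fixes `v` and is no derangement.
      with der {s ∙ ↔-sym t}
           (s , ↔-sym t , s∈S , (t , t∈S , λ _ → refl) , λ _ → refl)
    ... | inj₁ noFix = contradiction (Inverse.inverseʳ t (trans vˢ≡u (sym vᵗ≡u))) (noFix v)
    ... | inj₂ st⁻¹≈1 = λ x →
      trans (sym (Inverse.strictlyInverseˡ t (x ^ s))) (cong (_^ t) (st⁻¹≈1 x))

  multiplicityFree⇔regular :
    MultiplicityFree (GA X member) ⇔ RegularOfValency (DA X S) n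
  multiplicityFree⇔regular = mk⇔ (λ mf x → outs mf x , ins mf x) from
    where
    same : MultiplicityFree (GA X member) → ∀ x {i j} →
           x ^ perm i ≡ x ^ perm j → i ≡ j
    same mf x {i} {j} eq = card.injective $
      mf x _ (perm i , perm∈S i) (perm j , perm∈S j) eq refl

    outs : MultiplicityFree (GA X member) → ∀ x →
           HasCardinality (setoid X) (SimpleDigraph.Arc (DA X S) x) n
    outs mf x = record
      { to        = λ i → x ^ perm i , perm i , perm∈S i , refl
      ; cong      = cong (λ i → x ^ perm i)
      ; bijective = same mf x , λ (y , s , s∈S , xˢ≡y) →
          let i , pᵢ≈s = index s∈S
          in i , λ { refl → trans (pᵢ≈s x) xˢ≡y }
      }

    ins : MultiplicityFree (GA X member) → ∀ y →
          HasCardinality (setoid X) (λ x → SimpleDigraph.Arc (DA X S) x y) n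
    ins mf y = record
      { to        = λ i → pre i , perm i , perm∈S i , pre-perm i
      ; cong      = cong pre
      ; bijective =
          (λ {i} {j} eq → same mf (pre i)
            (trans (pre-perm i) (sym (trans (cong (_^ perm j) eq) (pre-perm j)))))
        , λ (x , s , s∈S , xˢ≡y) →
          let i , pᵢ≈s = index s∈S
          in i , λ { refl → Inverse.inverseʳ (perm i) (trans (sym xˢ≡y) (sym (pᵢ≈s x))) }
      }
      where
      pre : Fin n → X
      pre i = Inverse.from (perm i) y

      pre-perm : ∀ i → pre i ^ perm i ≡ y
      pre-perm i = Inverse.strictlyInverseˡ (perm i) y

    from : RegularOfValency (DA X S) n → MultiplicityFree (GA X member)
    from reg v u (s , s∈S) (t , t∈S) vˢ≡u vᵗ≡u =
      let i , pᵢ≈s = index s∈S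
          j , pⱼ≈t = index t∈S
          i≡j = surjective⇒injective position-surjective $ position-cong
                  (trans (pᵢ≈s v) (trans vˢ≡u (trans (sym vᵗ≡u) (sym (pⱼ≈t v)))))
      in λ x → trans (sym (pᵢ≈s x)) (trans (cong (λ l → x ^ perm l) i≡j) (pⱼ≈t x))
      where
      module out = Bijection (proj₁ (reg v))

      -- The number, among the arcs out of `v`, of the arc given by `perm i`. It is onto because
      -- every such arc comes from a member.
      position : Fin n → Fin n
      position i = proj₁ (out.strictlySurjective (v ^ perm i , perm i , perm∈S i , refl))

      position-spec : ∀ i → proj₁ (out.to (position i)) ≡ v ^ perm i
      position-spec i = proj₂ (out.strictlySurjective (v ^ perm i , perm i , perm∈S i , refl))

      position-cong : ∀ {i j} → v ^ perm i ≡ v ^ perm j → position i ≡ position j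
      position-cong {i} {j} eq =
        out.injective (trans (position-spec i) (trans eq (sym (position-spec j))))

      position-surjective : StrictlySurjective _≡_ position
      position-surjective l with out.to l in eq
      ... | y , w , w∈S , vʷ≡y =
        let i , pᵢ≈w = index w∈S
        in i , out.injective (trans (position-spec i)
                 (trans (pᵢ≈w v) (trans vʷ≡y (sym (cong proj₁ eq)))))

-- Switching along alternating cycles

module _ {X : Set ℓ} (finite : Finite X) (Arc : Rel X r) where

  private
    e   = proj₂ finite
    num = Inverse.from e

    _≟_ : DecidableEquality X
    _≟_ = inj⇒≟ (↔⇒↣ (↔-sym e))

    open DecMembership _≟_ using (_∈?_)

  swap : X → X → Perm X
  swap u v = e ↔-∘ (transpose (num u) (num v) ↔-∘ ↔-sym e)

  swap-first : ∀ u v → u ^ swap u v ≡ v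
  swap-first u v = Inverse.inverseˡ e (transpose-first (num u) (num v))

  swap-second : ∀ u v → v ^ swap u v ≡ u
  swap-second u v = Inverse.inverseˡ e (transpose-second (num u) (num v))

  swap-other : ∀ {u v z} → z ≢ u → z ≢ v → z ^ swap u v ≡ z
  swap-other z≢u z≢v = Inverse.inverseˡ e
    (transpose-other (z≢u ∘ ↔-injective (↔-sym e))
                     (z≢v ∘ ↔-injective (↔-sym e)))

  -- Path s y u b vs is a path on the vertices vs without repetition, starting
  -- at u, in the digraph with arcs z → w whenever Arc z (w ^ s), together with
  -- an arc of Γ from its last vertex to y. The value b is what u receives when
  -- each vertex takes over the image of the next one, and the last takes y.
  data Path (s : Perm X) (y : X) : X → X → List X → Set (ℓ ⊔ r) where
    end  : ∀ {u} → Arc u y → Path s y u y [ u ]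
    step : ∀ {u v b vs} → Arc u (v ^ s) → u ∉ vs → Path s y v b vs →
           Path s y u (v ^ s) (u ∷ vs)

  private
    variable
      s   : Perm X
      b u v x y : X
      vs  : List X

  start∈path : Path s y u b vs → u ∈ vs
  start∈path (end _)      = here refl
  start∈path (step _ _ _) = here refl

  path-from : Path s y v b vs → x ∉ vs → u ∈ vs →
              ∃₂ λ c ws → Path s y u c ws × x ∉ ws
  path-from p@(end _)      x∉vs (here refl)  = _ , _ , p , x∉vs
  path-from p@(step _ _ _) x∉vs (here refl)  = _ , _ , p , x∉vs
  path-from (step _ _ p)   x∉vs (there u∈vs) = path-from p (x∉vs ∘ there) u∈vs

  -- The path is built from the end of the walk: a repeated vertex discards the loop in between, a
  -- visit to `x` discards all that follows. Keeping `x` off the path allows putting it in front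
  -- later.
  erase-loops : Star (λ z w → Arc z (w ^ s)) u x →
                u ≡ x ⊎ ∃₂ λ b vs → Path s (x ^ s) u b vs × x ∉ vs
  erase-loops ε = inj₁ refl
  erase-loops {u = u} {x = x} (u→v ◅ walk) with u ≟ x | erase-loops walk
  ... | yes u≡x | _         = inj₁ u≡x
  ... | no  u≢x | inj₁ refl = inj₂ (_ , _ , end u→v , λ { (here x≡u) → u≢x (sym x≡u) })
  ... | no  u≢x | inj₂ (_ , vs , p , x∉vs) with u ∈? vs
  ...   | yes u∈vs = inj₂ (path-from p x∉vs u∈vs)
  ...   | no  u∉vs = inj₂ (_ , _ , step u→v u∉vs p ,
                       λ { (here x≡u) → u≢x (sym x≡u) ; (there x∈vs) → x∉vs x∈vs })

  -- The last vertex takes `x ^ s`, the value that `x` gives up, so the path closes to a cycle.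
  closed-path : Arc x (u ^ s) → Star (λ z w → Arc z (w ^ s)) u x →
                ∃ λ vs → Path s (x ^ s) x (u ^ s) vs
  closed-path x→u walk with erase-loops walk
  ... | inj₁ refl               = _ , end x→u
  ... | inj₂ (_ , _ , p , x∉vs) = _ , step x→u x∉vs p

  -- In the recursive call t has y at the head of the remaining path: the swaps
  -- carry y along the path, and every vertex they leave has received its value.
  rotate : Path s y u b vs → (t : Perm X) → u ^ t ≡ y →
           (∀ {z} → z ∈ vs → z ≢ u → z ^ t ≡ z ^ s) →
           ∃ λ t′ → u ^ t′ ≡ b
                  × (∀ {z} → z ∈ vs → Arc z (z ^ t′))
                  × (∀ {z} → z ∉ vs → z ^ t′ ≡ z ^ t)
  rotate (end u→y) t refl agree =
    t , refl , (λ { (here refl) → u→y }) , λ _ → refl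
  rotate {s = s} {u = u} (step {v = v} {vs = vs} u→v u∉vs p) t refl agree =
    let t′ , _ , arcs , fixed = rotate p t₁ (cong (_^ t) (swap-second u v)) agree₁
        u↦vˢ = trans (fixed u∉vs) (trans (cong (_^ t) (swap-first u v)) vᵗ≡vˢ)
    in t′ , u↦vˢ
     , (λ { (here refl)  → subst (Arc u) (sym u↦vˢ) u→v
          ; (there z∈vs) → arcs z∈vs })
     , λ z∉ → trans (fixed (z∉ ∘ there))
         (t₁-other (z∉ ∘ here) λ { refl → z∉ (there (start∈path p)) })
    where
    t₁ : Perm X
    t₁ = t ↔-∘ swap u v

    v≢u : v ≢ u
    v≢u refl = u∉vs (start∈path p)

    vᵗ≡vˢ : v ^ t ≡ v ^ s
    vᵗ≡vˢ = agree (there (start∈path p)) v≢u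

    t₁-other : ∀ {z} → z ≢ u → z ≢ v → z ^ t₁ ≡ z ^ t
    t₁-other z≢u z≢v = cong (_^ t) (swap-other z≢u z≢v)

    agree₁ : ∀ {z} → z ∈ vs → z ≢ v → z ^ t₁ ≡ z ^ s
    agree₁ z∈vs z≢v = trans (t₁-other z≢u z≢v) (agree (there z∈vs) z≢u)
      where
      z≢u : _ ≢ u
      z≢u refl = u∉vs z∈vs

-- Regular digraphs as derangement action digraphs

module _ {X : Set ℓ} (finite : Finite X) (Γ : SimpleDigraph X)
         (regular : RegularOfValency Γ k) where

  open SimpleDigraph Γ

  private
    module out x = Bijection (proj₁ (regular x))
    module inn x = Bijection (proj₂ (regular x))

    e = proj₂ finite

    open DecMembership (inj⇒≟ (↔⇒↣ (↔-sym e))) using (_∈?_)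

  module _ (s : Perm X) where

    private
      head : X × Fin k → X
      head (z , i) = proj₁ (out.to z i)

      -- An arc is named by its tail and its number among the arcs out of it.
      -- Its successor leaves the vertex with image head p under s, and has
      -- there the number that p has among the arcs into head p.
      next : X × Fin k → X × Fin k
      next p@(z , i) = Inverse.from s (head p) ,
        proj₁ (inn.strictlySurjective (head p) (z , proj₂ (out.to z i)))

      tail-next : ∀ p → proj₁ (inn.to (head p) (proj₂ (next p))) ≡ proj₁ p
      tail-next p@(z , i) =
        proj₂ (inn.strictlySurjective (head p) (z , proj₂ (out.to z i)))

      -- As `s` is a bijection, the new tail determines the head; the number at that head then
      -- determines the old tail.
      next-injective : Injective _≡_ _≡_ next
      next-injective {p@(z , i)} {q@(z′ , i′)} eq = same-arc same-tail same-head
        where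
        same-head : head p ≡ head q
        same-head = ↔-injective (↔-sym s) (cong proj₁ eq)

        same-tail : z ≡ z′
        same-tail = begin
          z                                       ≡⟨ tail-next p ⟨
          proj₁ (inn.to (head p) (proj₂ (next p))) ≡⟨ cong₂ (λ y j → proj₁ (inn.to y j)) same-head (cong proj₂ eq) ⟩
          proj₁ (inn.to (head q) (proj₂ (next q))) ≡⟨ tail-next q ⟩
          z′                                      ∎
          where open ≡-Reasoning

        same-arc : ∀ {z z′ i i′} → z ≡ z′ → head (z , i) ≡ head (z′ , i′) → (z , i) ≡ (z′ , i′)
        same-arc refl eq = cong (_ ,_) (out.injective _ eq)

      numbering : (X × Fin k) ↣ Fin (proj₁ finite ℕ.* k)
      numbering = ↔⇒↣ (↔-sym ((e ×-↔ ↔-id (Fin k)) ↔-∘ *↔×))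

      walk : ∀ m p → Star (λ z w → Arc z (w ^ s)) (proj₁ p) (proj₁ (iterate next p m))
      walk zero    p         = ε
      walk (suc m) p@(z , i) =
        subst (Arc z) (sym (Inverse.strictlyInverseˡ s (head p))) (proj₂ (out.to z i))
        ◅ walk m (next p)

    -- The successor of the arc from `x` to `y` leaves the vertex that `s` sends to `y`, and the
    -- orbit of `next` returns to that arc.
    closed-walk : ∀ {x y} → Arc x y → Star (λ z w → Arc z (w ^ s)) (Inverse.from s y) x
    closed-walk {x} {y} x→y
      with i , refl ← out.strictlySurjective x (y , x→y)
      with m , eq ← orbit-closed numbering next-injective (x , i)
      = subst (Star _ _) (cong proj₁ eq) (walk m (next (x , i)))

    -- Once `x` takes `y`, the displaced vertices pass images on around the cycle until `x ^ s` is
    -- taken up, so the result is again a permutation.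
    switch : ∀ {x y} → Arc x y →
             ∃ λ t → x ^ t ≡ y × (∀ z → Arc z (z ^ t) ⊎ z ^ t ≡ z ^ s)
    switch {x} {y} x→y =
      let vs , path = closed-path finite Arc {s = s}
                        (subst (Arc x) (sym s⁻¹s) x→y) (closed-walk x→y)
          t , x↦ , arcs , fixed = rotate finite Arc path s refl (λ _ _ → refl)
      in t , trans x↦ s⁻¹s , λ z → Sum.map arcs fixed (toSum (z ∈? vs))
      where
      s⁻¹s : Inverse.from s y ^ s ≡ y
      s⁻¹s = Inverse.strictlyInverseˡ s y

  ArcPerm : Pred (Perm X) ℓ
  ArcPerm s = ∀ x → Arc x (x ^ s)

  -- A switch sends a vertex along an arc or leaves its image alone, so vertices treated earlier
  -- stay good.
  arcPerm-onList : (∀ x → ∃ (Arc x)) → ∀ vs → ∃ λ s → ∀ {x} → x ∈ vs → Arc x (x ^ s)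
  arcPerm-onList outNbr []       = ↔-id X , λ ()
  arcPerm-onList outNbr (v ∷ vs) =
    let s , arcs        = arcPerm-onList outNbr vs
        y , v→y         = outNbr v
        t , vᵗ≡y , moved = switch s v→y
    in t , λ { (here refl)  → subst (Arc v) (sym vᵗ≡y) v→y
             ; {x} (there x∈vs) → [ id , (λ eq → subst (Arc x) (sym eq) (arcs x∈vs)) ]′ (moved x) }

  arcPerm-through : ∀ {x y} → Arc x y → ∃ λ s → ArcPerm s × x ^ s ≡ y
  arcPerm-through {x} {y} x→y =
    -- `i` shows that the valency is positive; as the valency is constant, `i` numbers an
    -- out-neighbour at every vertex.
    let i , _            = out.strictlySurjective x (y , x→y)
        s , arcs         = arcPerm-onList (λ z → out.to z i) (map (Inverse.to e) (allFin _))
        t , xᵗ≡y , moved = switch s x→y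
    in t , (λ z → [ id , (λ eq → subst (Arc z) (sym eq) (arcs (∈-vertices z))) ]′ (moved z)) , xᵗ≡y
    where
    ∈-vertices : ∀ z → z ∈ map (Inverse.to e) (allFin (proj₁ finite))
    ∈-vertices z = subst (_∈ _) (Inverse.strictlyInverseˡ e z)
                     (∈-map⁺ (Inverse.to e) (∈-allFin (Inverse.from e z)))

  -- Taking all permutations along arcs creates no new arcs; the given arc supplies a vertex and a
  -- member of `S`.
  regular⇒DA : HasArc Γ → IsDerangementActionDigraph Γ
  regular⇒DA (x , _ , x→y) = x , S , λ u v → mk⇔
    arcPerm-through
    λ (s , arcs , uˢ≡v) → subst (Arc u) uˢ≡v (arcs u)
    where
    S : DerangementSet X
    S = record
      { member       = ArcPerm
      ; respects     = λ s≈t arcs z → subst (Arc z) (s≈t z) (arcs z)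
      ; derangements = λ arcs z zˢ≡z → noLoop (sym zˢ≡z) (arcs z)
      ; nonempty     = let s , arcs , _ = arcPerm-through x→y in s , arcs
      }

theorem1p5 : (ℓ : Level) →
    ((X : Set ℓ) → X → (S : DerangementSet X) (n : ℕ) →
      let G = Sym X
          A = DerangementSet.member S
          SS⁻¹ = ProductSet G A (InverseSet G A)
      in HasCardinality (Group.setoid G) A n →
         (MultiplicityFree (GA X A) ⇔ (SS⁻¹ ⊆ Der X ∪ Identity G))
         × ((SS⁻¹ ⊆ Der X ∪ Identity G) ⇔ RegularOfValency (DA X S) n))
    × ((X : Set ℓ) → Finite X → (Γ : SimpleDigraph X) → Regular Γ → HasArc Γ →
       IsDerangementActionDigraph Γ)
theorem1p5 ℓ =
    (λ X _ S n card →
      let mf⇔der = multiplicityFree⇔quotientsDerange S card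
      in mf⇔der , multiplicityFree⇔regular S card ⇔-∘ ⇔-sym mf⇔der)
  , λ X finite Γ (k , regular) → regular⇒DA finite Γ regular
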